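{- Let $i,j$ be two vertices of the $d$-dimensional hypercube and let $P$ be its diffusion matrix. Then the function $t\mapsto (P^t)_{i,j}$, $t\in\mathbb{N}$, is unimodal.
   Context: The $d$-dimensional hypercube has vertex set $\{0,1\}^d$, vertices adjacent iff they differ in exactly one bit. Its diffusion matrix is $P_{i,j}=1/(2d)$ if $i,j$ are adjacent, $P_{i,i}=1/2$, and $0$ otherwise (the transition matrix of the lazy random walk). A function $f:\mathbb{N}\to\mathbb{R}$ is unimodal if there is $s\in\mathbb{N}$ such that $f$ restricted to $\{x\le s\}$ and $f$ restricted to $\{x\ge s\}$ are each monotone. -}

module Defs where

open import Data.Nat as ℕ using (ℕ; zero; suc)
open import Data.Bool using (Bool; true; false)
open import Data.Bool.Properties using () renaming (_≟_ to _≟ᴮ_)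
open import Data.Vec using (Vec; []; _∷_)
open import Data.Vec.Properties using (≡-dec)
open import Data.List using (List; []; _∷_; map; _++_; foldr)
open import Data.Integer using (+_)
open import Data.Rational using (ℚ; _/_; ½; 0ℚ; 1ℚ; _+_; _*_; _≤_)
open import Data.Product using (∃; _×_)
open import Data.Sum using (_⊎_)
open import Relation.Nullary using (yes; no)
open import Relation.Binary.PropositionalEquality using (_≡_)

Vertex : ℕ → Set
Vertex d = Vec Bool d

allVertices : (d : ℕ) → List (Vertex d)
allVertices zero = [] ∷ []
allVertices (suc d) = map (false ∷_) (allVertices d) ++ map (true ∷_) (allVertices d)

hamming : {d : ℕ} → Vertex d → Vertex d → ℕ
hamming [] [] = 0
hamming (a ∷ u) (b ∷ v) with a ≟ᴮ b
... | yes _ = hamming u v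
... | no _  = suc (hamming u v)

-- 1/(2d); only used for adjacent vertices, which exist only when d ≥ 1.
inv2d : ℕ → ℚ
inv2d zero = 0ℚ
inv2d (suc k) = + 1 / (2 ℕ.* suc k)

-- Diffusion matrix (lazy random walk): P i i = 1/2, P i j = 1/(2d) if adjacent, 0 otherwise.
P : (d : ℕ) → Vertex d → Vertex d → ℚ
P d i j with ≡-dec _≟ᴮ_ i j
... | yes _ = ½
... | no _ with hamming i j ℕ.≟ 1
...   | yes _ = inv2d d
...   | no _  = 0ℚ

sumV : (d : ℕ) → (Vertex d → ℚ) → ℚ
sumV d f = foldr (λ v acc → f v + acc) 0ℚ (allVertices d)

Id : (d : ℕ) → Vertex d → Vertex d → ℚ
Id d i j with ≡-dec _≟ᴮ_ i j
... | yes _ = 1ℚ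
... | no _  = 0ℚ

matMul : (d : ℕ) → (Vertex d → Vertex d → ℚ) → (Vertex d → Vertex d → ℚ) → Vertex d → Vertex d → ℚ
matMul d A B i j = sumV d (λ k → A i k * B k j)

matPow : (d : ℕ) → (Vertex d → Vertex d → ℚ) → ℕ → Vertex d → Vertex d → ℚ
matPow d M zero = Id d
matPow d M (suc t) = matMul d (matPow d M t) M

MonotoneOn : (ℕ → Set) → (ℕ → ℚ) → Set
MonotoneOn S f =
  (∀ x y → S x → S y → x ℕ.≤ y → f x ≤ f y) ⊎
  (∀ x y → S x → S y → x ℕ.≤ y → f y ≤ f x)

Unimodal : (ℕ → ℚ) → Set
Unimodal f = ∃ λ s → MonotoneOn (λ x → x ℕ.≤ s) f × MonotoneOn (λ x → s ℕ.≤ x) f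

{-# OPTIONS --safe #-}

-- In the variable u = eˣ − 1 the operator d/dx acts on coefficient sequences as
-- (D c) m = m c m + (m+1) c (m+1).  For vertices i, j of the d-cube at distance k put
-- f = uᵏ (u+2)ᵈ⁻ᵏ.  The product rule gives 2 D f = d f + Σ f_{i,j'} over the neighbours j' of j,
-- whence (Pᵗ) i j = (Dᵗ f) 0 / (2ᵈ dᵗ), and the increments of t ↦ (Pᵗ) i j have the signs of
-- (Dᵗ c) 0 with c = D f − d f.  If 0 < k < d then c = uᵏ⁻¹ (u+2)ᵈ⁻ᵏ⁻¹ (2k + (2k − d) u); so for
-- every k the sequence c has constant sign or exactly one sign change, from + to −.
-- Multiplication by u and by u+2 preserves this shape, and D moves the sign change
-- only to the left.  It reaches index 0 after finitely many steps, and from then on the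
-- increments are ≤ 0.
module Submission where

open import Defs
open import Data.Bool using (Bool; true; false; not)
open import Data.Bool.Properties using () renaming (_≟_ to _≟ᴮ_)
open import Data.Empty using (⊥-elim)
open import Data.Integer as ℤ using (ℤ; +_; -[1+_]; 0ℤ; 1ℤ; ∣_∣; +≤+; -≤+)
import Data.Integer.Properties as ℤ
open import Data.Integer.Tactic.RingSolver using () renaming (solve-∀ to solveℤ-∀)
open import Data.List using (List; []; _∷_; map; _++_; foldr)
open import Data.List.Properties using (foldr-map)
open import Data.Nat as ℕ using (ℕ; zero; suc; z≤n; s≤s)
open import Data.Nat.Coprimality using (1-coprimeTo) renaming (sym to coprime-sym)
import Data.Nat.Properties as ℕ
open import Data.Product using (∃; ∃₂; _×_; _,_)
import Data.Rational.Properties as ℚ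
import Data.Rational.Unnormalised as ℚᵘ
import Data.Rational.Unnormalised.Properties as ℚᵘ
open import Data.Sum using (_⊎_; inj₁; inj₂)
open import Data.Vec using ([]; _∷_)
open import Data.Vec.Properties using (≡-dec)
open import Level using (0ℓ)
open import Relation.Binary.PropositionalEquality
open import Relation.Nullary using (yes; no)
open import Relation.Nullary.Decidable using (dec⇒maybe)
open import Tactic.RingSolver using (solve-∀)
open import Tactic.RingSolver.Core.AlmostCommutativeRing using (AlmostCommutativeRing; fromCommutativeRing)

module IntegerSequences where
  open import Data.Integer using (_+_; _*_; _-_; _≤_; _<_; _≤?_)
  open import Data.Integer.Properties

  -- Coefficient sequences and the operators D, U and W.

  Seq : Set
  Seq = ℕ → ℤ

  -- U and W multiply the polynomial with coefficients c by u and by u + 2.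
  D U W : Seq → Seq
  D c m = + m * c m + + suc m * c (suc m)
  U c zero = 0ℤ
  U c (suc m) = c m
  W c m = + 2 * c m + U c m

  D^ : ℕ → Seq → Seq
  D^ zero c = c
  D^ (suc t) c = D (D^ t c)

  D^-D : ∀ t c → D^ t (D c) ≡ D (D^ t c)
  D^-D zero c = refl
  D^-D (suc t) c = cong D (D^-D t c)

  D-cong : ∀ {b c : Seq} → b ≗ c → D b ≗ D c
  D-cong e m = cong₂ _+_ (cong (+ m *_) (e m)) (cong (+ suc m *_) (e (suc m)))

  U-cong : ∀ {b c : Seq} → b ≗ c → U b ≗ U c
  U-cong e zero = refl
  U-cong e (suc m) = e m

  W-cong : ∀ {b c : Seq} → b ≗ c → W b ≗ W c
  W-cong e m = cong₂ _+_ (cong (+ 2 *_) (e m)) (U-cong e m)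

  UW≗WU : ∀ c → U (W c) ≗ W (U c)
  UW≗WU c zero = refl
  UW≗WU c (suc m) = refl

  -- Product rule: with u = eˣ - 1 the derivative of u is u + 1, and `c m + U c m` is the
  -- coefficient of (u + 1) c.
  D-U : ∀ c m → D (U c) m ≡ U (D c) m + (c m + U c m)
  D-U c zero = eq (c 0)
    where
    eq : ∀ x → 0ℤ * 0ℤ + 1ℤ * x ≡ 0ℤ + (x + 0ℤ)
    eq = solveℤ-∀
  D-U c (suc m) = eq (+ m) (c m) (c (suc m))
    where
    eq : ∀ n x y → (1ℤ + n) * x + (+ 2 + n) * y ≡ (n * x + (1ℤ + n) * y) + (y + x)
    eq = solveℤ-∀

  -- The same product rule, since u + 2 also has derivative u + 1.
  D-W : ∀ c m → D (W c) m ≡ W (D c) m + (c m + U c m)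
  D-W c zero = eq (c 0) (c 1)
    where
    eq : ∀ x y → 0ℤ * (+ 2 * x + 0ℤ) + 1ℤ * (+ 2 * y + x) ≡ + 2 * (0ℤ * x + 1ℤ * y) + 0ℤ + (x + 0ℤ)
    eq = solveℤ-∀
  D-W c (suc m) = eq (+ m) (c m) (c (suc m)) (c (suc (suc m)))
    where
    eq : ∀ n x y z → (1ℤ + n) * (+ 2 * y + x) + (+ 2 + n) * (+ 2 * z + y)
       ≡ + 2 * ((1ℤ + n) * y + (+ 2 + n) * z) + (n * x + (1ℤ + n) * y) + (y + x)
    eq = solveℤ-∀

  -- Sign patterns of coefficient sequences.

  scale-≥0 : ∀ n {x} → 0ℤ ≤ x → 0ℤ ≤ + n * x
  scale-≥0 n {x} h = subst (_≤ + n * x) (*-zeroʳ (+ n)) (*-monoˡ-≤-nonNeg (+ n) h)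

  scale-≤0 : ∀ n {x} → x ≤ 0ℤ → + n * x ≤ 0ℤ
  scale-≤0 n {x} h = subst (+ n * x ≤_) (*-zeroʳ (+ n)) (*-monoˡ-≤-nonNeg (+ n) h)

  scale-<0 : ∀ n {x} → x < 0ℤ → + suc n * x < 0ℤ
  scale-<0 n {x} h = subst (+ suc n * x <_) (*-zeroʳ (+ suc n)) (*-monoˡ-<-pos (+ suc n) h)

  NonNeg NonPos : Seq → Set
  NonNeg c = ∀ m → 0ℤ ≤ c m
  NonPos c = ∀ m → c m ≤ 0ℤ

  D-nonNeg : ∀ {c} → NonNeg c → NonNeg (D c)
  D-nonNeg h m = +-mono-≤ (scale-≥0 m (h m)) (scale-≥0 (suc m) (h (suc m)))

  D-nonPos : ∀ {c} → NonPos c → NonPos (D c)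
  D-nonPos h m = +-mono-≤ (scale-≤0 m (h m)) (scale-≤0 (suc m) (h (suc m)))

  U-nonNeg : ∀ {c} → NonNeg c → NonNeg (U c)
  U-nonNeg h zero = ≤-refl
  U-nonNeg h (suc m) = h m

  U-nonPos : ∀ {c} → NonPos c → NonPos (U c)
  U-nonPos h zero = ≤-refl
  U-nonPos h (suc m) = h m

  W-nonNeg : ∀ {c} → NonNeg c → NonNeg (W c)
  W-nonNeg h m = +-mono-≤ (scale-≥0 2 (h m)) (U-nonNeg h m)

  W-nonPos : ∀ {c} → NonPos c → NonPos (W c)
  W-nonPos h m = +-mono-≤ (scale-≤0 2 (h m)) (U-nonPos h m)

  -- Zeros are allowed away from n, but the entry at n is strictly negative: this fixes the position
  -- of the change and drives the descent below.
  record ChangesAt (n : ℕ) (c : Seq) : Set where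
    constructor changes
    field
      before : ∀ m → m ℕ.< n → 0ℤ ≤ c m
      at     : c n < 0ℤ
      after  : ∀ m → n ℕ.< m → c m ≤ 0ℤ
  open ChangesAt

  ChangesAt-resp : ∀ {n b c} → b ≗ c → ChangesAt n b → ChangesAt n c
  ChangesAt-resp e (changes p q r) = changes
    (λ m h → subst (0ℤ ≤_) (e m) (p m h))
    (subst (_< 0ℤ) (e _) q)
    (λ m h → subst (_≤ 0ℤ) (e m) (r m h))

  changes⇒nonPos : ∀ {c} → ChangesAt 0 c → NonPos c
  changes⇒nonPos h zero = <⇒≤ (at h)
  changes⇒nonPos h (suc m) = after h (suc m) (s≤s z≤n)

  -- W and D each leave exactly one index, just before a negative entry, whose sign is unknown;
  -- either sign there gives a single change.
  decide-at : ∀ {n} c → (∀ m → m ℕ.< n → 0ℤ ≤ c m) → c (suc n) < 0ℤ →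
              (∀ m → suc n ℕ.< m → c m ≤ 0ℤ) → ChangesAt n c ⊎ ChangesAt (suc n) c
  decide-at {n} c b a r with 0ℤ ≤? c n
  ... | no c<0 = inj₁ (changes b (≰⇒> c<0) r′)
    where
    r′ : ∀ m → n ℕ.< m → c m ≤ 0ℤ
    r′ m n<m with ℕ.m≤n⇒m<n∨m≡n n<m
    ... | inj₁ n+1<m = r m n+1<m
    ... | inj₂ refl = <⇒≤ a
  ... | yes 0≤c = inj₂ (changes b′ a r)
    where
    b′ : ∀ m → m ℕ.< suc n → 0ℤ ≤ c m
    b′ m (s≤s m≤n) with ℕ.m≤n⇒m<n∨m≡n m≤n
    ... | inj₁ m<n = b m m<n
    ... | inj₂ refl = 0≤c

  U-changes : ∀ {n c} → ChangesAt n c → ChangesAt (suc n) (U c)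
  U-changes {n} {c} h = changes b (at h) r
    where
    b : ∀ m → m ℕ.< suc n → 0ℤ ≤ U c m
    b zero _ = ≤-refl
    b (suc m) (s≤s m<n) = before h m m<n
    r : ∀ m → suc n ℕ.< m → U c m ≤ 0ℤ
    r (suc m) (s≤s n<m) = after h m n<m

  -- The two terms 2 c m and c (m - 1) have compatible signs except at m = n; at m = n + 1 the
  -- second one is the negative entry c n.
  W-changes : ∀ {n c} → ChangesAt n c → ∃ λ n′ → ChangesAt n′ (W c)
  W-changes {n} {c} h with decide-at {n} (W c) b a r
    where
    Uh = U-changes h
    b : ∀ m → m ℕ.< n → 0ℤ ≤ W c m
    b m m<n = +-mono-≤ (scale-≥0 2 (before h m m<n)) (before Uh m (ℕ.m<n⇒m<1+n m<n))
    a : W c (suc n) < 0ℤ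
    a = +-mono-≤-< (scale-≤0 2 (after h (suc n) ℕ.≤-refl)) (at Uh)
    r : ∀ m → suc n ℕ.< m → W c m ≤ 0ℤ
    r m n+1<m = +-mono-≤ (scale-≤0 2 (after h m (ℕ.<⇒≤ n+1<m))) (after Uh m n+1<m)
  ... | inj₁ x = _ , x
  ... | inj₂ x = _ , x

  -- (D c) m mixes only c m and c (m + 1), so opposite signs can meet only at m = n, and the change
  -- stays or moves left by one.
  D-changes : ∀ {n c} → ChangesAt (suc n) c → ChangesAt n (D c) ⊎ ChangesAt (suc n) (D c)
  D-changes {n} {c} h = decide-at (D c) b a r
    where
    b : ∀ m → m ℕ.< n → 0ℤ ≤ D c m
    b m m<n = +-mono-≤ (scale-≥0 m (before h m (ℕ.m<n⇒m<1+n m<n)))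
                       (scale-≥0 (suc m) (before h (suc m) (s≤s m<n)))
    a : D c (suc n) < 0ℤ
    a = +-mono-<-≤ (scale-<0 n (at h)) (scale-≤0 (suc (suc n)) (after h _ ℕ.≤-refl))
    r : ∀ m → suc n ℕ.< m → D c m ≤ 0ℤ
    r m n<m = +-mono-≤ (scale-≤0 m (after h m n<m)) (scale-≤0 (suc m) (after h (suc m) (ℕ.m<n⇒m<1+n n<m)))

  -- Signs at index 0 under iteration of D.

  PlusThenMinus : Seq → Set
  PlusThenMinus δ = ∃ λ s → (∀ t → t ℕ.< s → 0ℤ ≤ δ t) × (∀ t → s ℕ.≤ t → δ t ≤ 0ℤ)

  orbit : Seq → Seq
  orbit c t = D^ t c 0

  orbit-suc : ∀ c t → orbit (D c) t ≡ orbit c (suc t)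
  orbit-suc c t = cong (λ b → b 0) (D^-D t c)

  orbit-nonNeg : ∀ {c} → NonNeg c → ∀ t → NonNeg (D^ t c)
  orbit-nonNeg h zero = h
  orbit-nonNeg h (suc t) = D-nonNeg (orbit-nonNeg h t)

  orbit-nonPos : ∀ {c} → NonPos c → ∀ t → NonPos (D^ t c)
  orbit-nonPos h zero = h
  orbit-nonPos h (suc t) = D-nonPos (orbit-nonPos h t)

  nonPos⇒plusThenMinus : ∀ {c} → NonPos c → PlusThenMinus (orbit c)
  nonPos⇒plusThenMinus h = 0 , (λ _ ()) , (λ t _ → orbit-nonPos h t 0)

  plusThenMinus-suc : ∀ {c} → 0ℤ ≤ c 0 → PlusThenMinus (orbit (D c)) → PlusThenMinus (orbit c)
  plusThenMinus-suc {c} h (s , p , q) = suc s , p′ , q′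
    where
    p′ : ∀ t → t ℕ.< suc s → 0ℤ ≤ orbit c t
    p′ zero _ = h
    p′ (suc t) (s≤s t<s) = subst (0ℤ ≤_) (orbit-suc c t) (p t t<s)
    q′ : ∀ t → suc s ℕ.≤ t → orbit c t ≤ 0ℤ
    q′ (suc t) (s≤s s≤t) = subst (_≤ 0ℤ) (orbit-suc c t) (q t s≤t)

  ≤∣∣ : ∀ i → i ≤ + ∣ i ∣
  ≤∣∣ (+ n) = ≤-refl
  ≤∣∣ -[1+ n ] = -≤+

  i<0⇒i+1≤0 : ∀ {x} → x < 0ℤ → 1ℤ + x ≤ 0ℤ
  i<0⇒i+1≤0 = i<j⇒suc[i]≤j

  -- Integrality enters here: a negative integer y is at most -1, so ∣ x ∣ copies of it outweigh x.
  -- This supplies the starting fuel X of `descend`.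
  initial-gap : ∀ x {y} → y < 0ℤ → x + + ∣ x ∣ * y ≤ 0ℤ
  initial-gap x {y} y<0 = begin
    x + + ∣ x ∣ * y           ≤⟨ +-monoˡ-≤ _ (≤∣∣ x) ⟩
    + ∣ x ∣ + + ∣ x ∣ * y     ≡⟨ eq (+ ∣ x ∣) y ⟩
    + ∣ x ∣ * (1ℤ + y)        ≤⟨ scale-≤0 ∣ x ∣ (i<0⇒i+1≤0 y<0) ⟩
    0ℤ                        ∎
    where
    open ≤-Reasoning
    eq : ∀ a y → a + a * y ≡ a * (1ℤ + y)
    eq = solveℤ-∀

  -- Each application of D lowers by one the multiple X of −c (n+1) that dominates c n,
  -- so after at most X + 1 steps c n has become negative.
  changes⇒plusThenMinus : ∀ n {c} → ChangesAt n c → PlusThenMinus (orbit c)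
  descend : ∀ n X {c} → ChangesAt (suc n) c → c n + + X * c (suc n) ≤ 0ℤ → PlusThenMinus (orbit c)

  changes⇒plusThenMinus zero h = nonPos⇒plusThenMinus (changes⇒nonPos h)
  changes⇒plusThenMinus (suc n) {c} h = descend n ∣ c n ∣ h (initial-gap (c n) (at h))

  -- The change sits at n + 1 > 0, so the entry at index 0 is still nonnegative and the orbit may be
  -- studied one step later.
  descend n X {c} h gap = plusThenMinus-suc (before h 0 (s≤s z≤n)) (next X gap (D-changes h))
    where
    open ≤-Reasoning
    x = c n
    y = c (suc n)
    next : ∀ X → x + + X * y ≤ 0ℤ → ChangesAt n (D c) ⊎ ChangesAt (suc n) (D c) → PlusThenMinus (orbit (D c))
    next _ _ (inj₁ h′) = changes⇒plusThenMinus n h′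
    -- With no fuel left c n ≤ 0, so (D c) n is negative and the change cannot have stayed at n + 1.
    next zero gap (inj₂ h′) = ⊥-elim (<⇒≱ Dc<0 (before h′ n ℕ.≤-refl))
      where
      x≤0 : x ≤ 0ℤ
      x≤0 = subst (_≤ 0ℤ) (+-identityʳ x) gap
      Dc<0 : D c n < 0ℤ
      Dc<0 = +-mono-≤-< (scale-≤0 n x≤0) (scale-<0 n (at h))
    -- After dropping the nonpositive contribution of c (n + 2), what remains is n times the old gap
    -- plus X + 1 copies of y, both ≤ 0.
    next (suc X) gap (inj₂ h′) = descend n X h′ (begin
      D c n + + X * D c (suc n)                           ≤⟨ +-monoʳ-≤ (D c n) (*-monoˡ-≤-nonNeg (+ X) tail) ⟩
      D c n + + X * (+ suc n * y)                         ≡⟨ eq (+ n) (+ X) x y ⟩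
      + n * (x + + suc X * y) + + suc X * y               ≤⟨ +-mono-≤ (scale-≤0 n gap) (scale-≤0 (suc X) (<⇒≤ (at h))) ⟩
      0ℤ ∎)
      where
      tail : D c (suc n) ≤ + suc n * y
      tail = begin
        D c (suc n)       ≤⟨ +-monoʳ-≤ (+ suc n * y) (scale-≤0 (suc (suc n)) (after h _ ℕ.≤-refl)) ⟩
        + suc n * y + 0ℤ  ≡⟨ +-identityʳ _ ⟩
        + suc n * y       ∎
      eq : ∀ n X x y → (n * x + (1ℤ + n) * y) + X * ((1ℤ + n) * y) ≡ n * (x + (1ℤ + X) * y) + (1ℤ + X) * y
      eq = solveℤ-∀

  -- The polynomials uᵏ (u + 2)ˡ and their defects.

  one : Seq
  one zero = 1ℤ
  one (suc m) = 0ℤ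

  -- uᵏ (u + 2)ˡ
  poly : ℕ → ℕ → Seq
  poly zero zero = one
  poly zero (suc l) = W (poly zero l)
  poly (suc k) l = U (poly k l)

  -- `poly` peels off the factors u first, so a factor u + 2 has to be commuted past them.
  poly-W : ∀ k l → poly k (suc l) ≗ W (poly k l)
  poly-W zero l m = refl
  poly-W (suc k) l m = trans (U-cong (poly-W k l) m) (UW≗WU (poly k l) m)

  one-nonNeg : NonNeg one
  one-nonNeg zero = +≤+ z≤n
  one-nonNeg (suc m) = ≤-refl

  poly-nonNeg : ∀ k l → NonNeg (poly k l)
  poly-nonNeg zero zero = one-nonNeg
  poly-nonNeg zero (suc l) = W-nonNeg (poly-nonNeg zero l)
  poly-nonNeg (suc k) l = U-nonNeg (poly-nonNeg k l)

  -- The sequence D f - d f whose orbit at index 0 carries the signs of the increments.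
  defect : ℤ → Seq → Seq
  defect d c m = D c m - d * c m

  defect-cong : ∀ d {b c} → b ≗ c → defect d b ≗ defect d c
  defect-cong d e m = cong₂ (λ x y → x - d * y) (D-cong e m) (e m)

  U-defect : ∀ d c m → U (defect d c) m ≡ U (D c) m - d * U c m
  U-defect d c zero = eq d
    where
    eq : ∀ d → 0ℤ ≡ 0ℤ - d * 0ℤ
    eq = solveℤ-∀
  U-defect d c (suc m) = refl

  -- The product rule adds (u + 1) c and the larger d removes u c, which leaves c.
  defect-U : ∀ d c m → defect (1ℤ + d) (U c) m ≡ U (defect d c) m + c m
  defect-U d c m = begin
    D (U c) m - (1ℤ + d) * U c m                       ≡⟨ cong (_- (1ℤ + d) * U c m) (D-U c m) ⟩
    U (D c) m + (c m + U c m) - (1ℤ + d) * U c m       ≡⟨ eq (U (D c) m) (c m) (U c m) d ⟩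
    U (D c) m - d * U c m + c m                        ≡⟨ cong (_+ c m) (sym (U-defect d c m)) ⟩
    U (defect d c) m + c m                             ∎
    where
    open ≡-Reasoning
    eq : ∀ a x u d → a + (x + u) - (1ℤ + d) * u ≡ a - d * u + x
    eq = solveℤ-∀

  -- Here the larger d removes (u + 2) c against the added (u + 1) c, which leaves -c.
  defect-W : ∀ d c m → defect (1ℤ + d) (W c) m ≡ W (defect d c) m - c m
  defect-W d c m = begin
    D (W c) m - (1ℤ + d) * W c m
      ≡⟨ cong (_- (1ℤ + d) * W c m) (D-W c m) ⟩
    + 2 * D c m + U (D c) m + (c m + U c m) - (1ℤ + d) * (+ 2 * c m + U c m)
      ≡⟨ eq (D c m) (U (D c) m) (c m) (U c m) d ⟩
    + 2 * (D c m - d * c m) + (U (D c) m - d * U c m) - c m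
      ≡⟨ cong (λ z → + 2 * defect d c m + z - c m) (sym (U-defect d c m)) ⟩
    W (defect d c) m - c m ∎
    where
    open ≡-Reasoning
    eq : ∀ a b x u d → + 2 * a + b + (x + u) - (1ℤ + d) * (+ 2 * x + u)
       ≡ + 2 * (a - d * x) + (b - d * u) - x
    eq = solveℤ-∀

  defectPoly : ℕ → ℕ → Seq
  defectPoly k l = defect (+ (k ℕ.+ l)) (poly k l)

  defectPoly-00 : ∀ m → defectPoly 0 0 m ≡ 0ℤ
  defectPoly-00 zero = refl
  defectPoly-00 (suc m) = eq (+ m)
    where
    eq : ∀ n → (1ℤ + n) * 0ℤ + (+ 2 + n) * 0ℤ - 0ℤ * 0ℤ ≡ 0ℤ
    eq = solveℤ-∀

  defectPoly-U : ∀ k l m → defectPoly (suc k) l m ≡ U (defectPoly k l) m + poly k l m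
  defectPoly-U k l = defect-U (+ (k ℕ.+ l)) (poly k l)

  defectPoly-W : ∀ k l m → defectPoly k (suc l) m ≡ W (defectPoly k l) m - poly k l m
  defectPoly-W k l m = begin
    defect (+ (k ℕ.+ suc l)) (poly k (suc l)) m    ≡⟨ cong (λ n → defect (+ n) (poly k (suc l)) m) (ℕ.+-suc k l) ⟩
    defect (+ suc (k ℕ.+ l)) (poly k (suc l)) m    ≡⟨ defect-cong (+ suc (k ℕ.+ l)) (poly-W k l) m ⟩
    defect (+ suc (k ℕ.+ l)) (W (poly k l)) m      ≡⟨ defect-W (+ (k ℕ.+ l)) (poly k l) m ⟩
    W (defectPoly k l) m - poly k l m                 ∎
    where open ≡-Reasoning

  -- Case i = j: starting from 0, each factor u + 2 subtracts a polynomial with nonnegative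
  -- coefficients.
  defectPoly-nonPos : ∀ l → NonPos (defectPoly 0 l)
  defectPoly-nonPos zero m = ≤-reflexive (defectPoly-00 m)
  defectPoly-nonPos (suc l) m = subst (_≤ 0ℤ) (sym (defectPoly-W 0 l m))
    (+-mono-≤ (W-nonPos (defectPoly-nonPos l) m) (neg-mono-≤ (poly-nonNeg 0 l m)))

  -- Antipodal case: D uᵏ = k uᵏ⁻¹ (u + 1), so subtracting k uᵏ leaves k uᵏ⁻¹, here with k + 1 for
  -- k.
  defectPoly-k0 : ∀ k m → defectPoly (suc k) 0 m ≡ + suc k * poly k 0 m
  defectPoly-k0 zero m = begin
    defectPoly 1 0 m                    ≡⟨ defectPoly-U 0 0 m ⟩
    U (defectPoly 0 0) m + one m        ≡⟨ cong (_+ one m) (U0 m) ⟩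
    0ℤ + one m                       ≡⟨ eq (one m) ⟩
    1ℤ * one m                       ∎
    where
    open ≡-Reasoning
    eq : ∀ x → 0ℤ + x ≡ 1ℤ * x
    eq = solveℤ-∀
    U0 : ∀ m → U (defectPoly 0 0) m ≡ 0ℤ
    U0 zero = refl
    U0 (suc m) = defectPoly-00 m
  defectPoly-k0 (suc k) m = begin
    defectPoly (suc (suc k)) 0 m                        ≡⟨ defectPoly-U (suc k) 0 m ⟩
    U (defectPoly (suc k) 0) m + poly (suc k) 0 m          ≡⟨ cong (_+ poly (suc k) 0 m) (U-cong (defectPoly-k0 k) m) ⟩
    U (λ n → + suc k * poly k 0 n) m + poly (suc k) 0 m    ≡⟨ Uscale m ⟩
    + suc (suc k) * poly (suc k) 0 m                    ∎
    where
    open ≡-Reasoning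
    eq : ∀ k x → k * x + x ≡ (1ℤ + k) * x
    eq = solveℤ-∀
    eq0 : ∀ k → 0ℤ + 0ℤ ≡ k * 0ℤ
    eq0 = solveℤ-∀
    Uscale : ∀ m → U (λ n → + suc k * poly k 0 n) m + U (poly k 0) m ≡ + suc (suc k) * U (poly k 0) m
    Uscale zero = eq0 (+ suc (suc k))
    Uscale (suc m) = eq (+ suc k) (poly k 0 m)

  -- Multiplication by the linear polynomial a + b u.
  lin : ℤ → ℤ → Seq → Seq
  lin a b c m = a * c m + b * U c m

  lin-cong : ∀ a b {c c′} → c ≗ c′ → lin a b c ≗ lin a b c′
  lin-cong a b e m = cong₂ (λ x y → a * x + b * y) (e m) (U-cong e m)

  lin-U : ∀ a b c → U (lin a b c) ≗ lin a b (U c)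
  lin-U a b c zero = eq a b
    where
    eq : ∀ a b → 0ℤ ≡ a * 0ℤ + b * 0ℤ
    eq = solveℤ-∀
  lin-U a b c (suc m) = refl

  lin-W : ∀ a b c → W (lin a b c) ≗ lin a b (W c)
  lin-W a b c m = begin
    + 2 * (a * c m + b * U c m) + U (lin a b c) m               ≡⟨ cong (λ z → + 2 * lin a b c m + z) (lin-U a b c m) ⟩
    + 2 * (a * c m + b * U c m) + (a * U c m + b * U (U c) m)   ≡⟨ eq a b (c m) (U c m) (U (U c) m) ⟩
    a * W c m + b * W (U c) m                                   ≡⟨ cong (λ z → a * W c m + b * z) (sym (UW≗WU c m)) ⟩
    a * W c m + b * U (W c) m                                   ∎
    where
    open ≡-Reasoning
    eq : ∀ a b x y z → + 2 * (a * x + b * y) + (a * y + b * z) ≡ a * (+ 2 * x + y) + b * (+ 2 * y + z)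
    eq = solveℤ-∀

  -- Induction on l from the antipodal case: each new factor u + 2 subtracts u times the current
  -- `poly`, lowering the coefficient b by one. With distance k + 1 and d = k + l + 2, the number 2
  -- (k + 1) - d is k - l.
  defectPoly-formula : ∀ k l → defectPoly (suc k) (suc l) ≗ lin (+ 2 * + suc k) (+ k - + l) (poly k l)
  defectPoly-formula k zero m = begin
    defectPoly (suc k) 1 m
      ≡⟨ defectPoly-W (suc k) 0 m ⟩
    W (defectPoly (suc k) 0) m - U (poly k 0) m
      ≡⟨ cong (_- U (poly k 0) m) (W-cong {defectPoly (suc k) 0} {λ n → + suc k * poly k 0 n} (defectPoly-k0 k) m) ⟩
    W (λ n → + suc k * poly k 0 n) m - U (poly k 0) m
      ≡⟨ cong (λ z → + 2 * (+ suc k * poly k 0 m) + z - U (poly k 0) m) (Uscale m) ⟩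
    + 2 * (+ suc k * poly k 0 m) + + suc k * U (poly k 0) m - U (poly k 0) m
      ≡⟨ eq (+ k) (poly k 0 m) (U (poly k 0) m) ⟩
    lin (+ 2 * + suc k) (+ k - 0ℤ) (poly k 0) m ∎
    where
    open ≡-Reasoning
    eq : ∀ k x u → + 2 * ((1ℤ + k) * x) + (1ℤ + k) * u - u ≡ (+ 2 * (1ℤ + k)) * x + (k - 0ℤ) * u
    eq = solveℤ-∀
    Uscale : ∀ m → U (λ n → + suc k * poly k 0 n) m ≡ + suc k * U (poly k 0) m
    Uscale zero = sym (*-zeroʳ (+ suc k))
    Uscale (suc m) = refl
  defectPoly-formula k (suc l) m = begin
    defectPoly (suc k) (suc (suc l)) m
      ≡⟨ defectPoly-W (suc k) (suc l) m ⟩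
    W (defectPoly (suc k) (suc l)) m - poly (suc k) (suc l) m
      ≡⟨ cong (_- poly (suc k) (suc l) m) (W-cong (defectPoly-formula k l) m) ⟩
    W (lin (+ 2 * + suc k) (+ k - + l) (poly k l)) m - poly (suc k) (suc l) m
      ≡⟨ cong (_- poly (suc k) (suc l) m) (lin-W (+ 2 * + suc k) (+ k - + l) (poly k l) m) ⟩
    lin (+ 2 * + suc k) (+ k - + l) (W (poly k l)) m - poly (suc k) (suc l) m
      ≡⟨ cong (_- poly (suc k) (suc l) m) (lin-cong (+ 2 * + suc k) (+ k - + l) (λ n → sym (poly-W k l n)) m) ⟩
    lin (+ 2 * + suc k) (+ k - + l) (poly k (suc l)) m - U (poly k (suc l)) m
      ≡⟨ eq (+ 2 * + suc k) (+ k) (+ l) (poly k (suc l) m) (U (poly k (suc l)) m) ⟩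
    lin (+ 2 * + suc k) (+ k - + suc l) (poly k (suc l)) m ∎
    where
    open ≡-Reasoning
    eq : ∀ a k l x u → a * x + (k - l) * u - u ≡ a * x + (k - (1ℤ + l)) * u
    eq = solveℤ-∀

  lin-nonNeg : ∀ a b {c} → 0ℤ ≤ b → NonNeg c → NonNeg (lin (+ a) b c)
  lin-nonNeg a (+ b) _ h m = +-mono-≤ (scale-≥0 a (h m)) (scale-≥0 b (U-nonNeg h m))

  -- The sequence of a + b u changes sign at index 1; the remaining factors u and u + 2 preserve a
  -- single change.
  lin-changes : ∀ a {b} → b < 0ℤ → ∀ k l → ∃ λ n → ChangesAt n (lin (+ a) b (poly k l))
  lin-changes a {b} b<0 zero zero = 1 , changes left here right
    where
    left : ∀ m → m ℕ.< 1 → 0ℤ ≤ lin (+ a) b one m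
    left zero _ = subst (0ℤ ≤_) (eq (+ a) b) (+≤+ {0} {a} z≤n)
      where
      eq : ∀ a b → a ≡ a * 1ℤ + b * 0ℤ
      eq = solveℤ-∀
    left (suc m) (s≤s ())
    here : lin (+ a) b one 1 < 0ℤ
    here = subst (_< 0ℤ) (eq (+ a) b) b<0
      where
      eq : ∀ a b → b ≡ a * 0ℤ + b * 1ℤ
      eq = solveℤ-∀
    right : ∀ m → 1 ℕ.< m → lin (+ a) b one m ≤ 0ℤ
    right (suc (suc m)) _ = ≤-reflexive (eq (+ a) b)
      where
      eq : ∀ a b → a * 0ℤ + b * 0ℤ ≡ 0ℤ
      eq = solveℤ-∀
    right (suc zero) (s≤s ())
  lin-changes a {b} b<0 zero (suc l) with lin-changes a b<0 zero l
  ... | _ , h with W-changes h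
  ... | n , h′ = n , ChangesAt-resp (lin-W (+ a) b (poly 0 l)) h′
  lin-changes a {b} b<0 (suc k) l with lin-changes a b<0 k l
  ... | n , h = suc n , ChangesAt-resp (lin-U (+ a) b (poly k l)) (U-changes h)

  -- Signs of the increments for a pair of vertices.

  AtMostOneSignChange : Seq → Set
  AtMostOneSignChange δ = (∀ t → 0ℤ ≤ δ t) ⊎ PlusThenMinus δ

  Signed : Seq → Set
  Signed c = NonNeg c ⊎ NonPos c ⊎ ∃ λ n → ChangesAt n c

  Signed-resp : ∀ {b c} → b ≗ c → Signed b → Signed c
  Signed-resp e (inj₁ h) = inj₁ (λ m → subst (0ℤ ≤_) (e m) (h m))
  Signed-resp e (inj₂ (inj₁ h)) = inj₂ (inj₁ (λ m → subst (_≤ 0ℤ) (e m) (h m)))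
  Signed-resp e (inj₂ (inj₂ (n , h))) = inj₂ (inj₂ (n , ChangesAt-resp e h))

  orbit-sign : ∀ {c} → Signed c → AtMostOneSignChange (orbit c)
  orbit-sign (inj₁ h) = inj₁ (λ t → orbit-nonNeg h t 0)
  orbit-sign (inj₂ (inj₁ h)) = inj₂ (nonPos⇒plusThenMinus h)
  orbit-sign (inj₂ (inj₂ (n , h))) = inj₂ (changes⇒plusThenMinus n h)

  -- Besides equal and antipodal vertices, the linear factor decides: its leading coefficient is
  -- nonnegative exactly when at least as many bits differ as agree.
  defectPoly-signed : ∀ k l → Signed (defectPoly k l)
  defectPoly-signed zero l = inj₂ (inj₁ (defectPoly-nonPos l))
  defectPoly-signed (suc k) zero =
    inj₁ (λ m → subst (0ℤ ≤_) (sym (defectPoly-k0 k m)) (scale-≥0 (suc k) (poly-nonNeg k 0 m)))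
  defectPoly-signed (suc k) (suc l) = Signed-resp (λ m → sym (defectPoly-formula k l m)) go
    where
    go : Signed (lin (+ 2 * + suc k) (+ k - + l) (poly k l))
    go with 0ℤ ≤? (+ k - + l)
    ... | yes b≥0 = inj₁ (lin-nonNeg (2 ℕ.* suc k) (+ k - + l) b≥0 (poly-nonNeg k l))
    ... | no b≱0 = inj₂ (inj₂ (lin-changes (2 ℕ.* suc k) (≰⇒> b≱0) k l))

  -- An agreeing bit gives eˣ + 1 and a differing bit eˣ - 1. Their product is the exponential
  -- generating function of 2ᵈ dᵗ (Pᵗ) i j.
  coordinate : Bool → Bool → Seq → Seq
  coordinate false false = W
  coordinate true true = W
  coordinate false true = U
  coordinate true false = U

  cubePoly : ∀ {d} → Vertex d → Vertex d → Seq
  cubePoly [] [] = one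
  cubePoly (a ∷ i) (b ∷ j) = coordinate a b (cubePoly i j)

  cubePoly≗poly : ∀ {d} (i j : Vertex d) → ∃₂ λ k l → k ℕ.+ l ≡ d × cubePoly i j ≗ poly k l
  cubePoly≗poly [] [] = 0 , 0 , refl , λ _ → refl
  cubePoly≗poly (a ∷ i) (b ∷ j) with cubePoly≗poly i j
  ... | k , l , refl , e = go a b
    where
    same = k , suc l , ℕ.+-suc k l , λ m → trans (W-cong e m) (sym (poly-W k l m))
    diff = suc k , l , refl , U-cong e
    go : ∀ a b → ∃₂ λ k′ l′ → k′ ℕ.+ l′ ≡ suc (k ℕ.+ l) × coordinate a b (cubePoly i j) ≗ poly k′ l′
    go false false = same
    go true true = same
    go false true = diff
    go true false = diff

  defect-signed : ∀ {d} (i j : Vertex d) → Signed (defect (+ d) (cubePoly i j))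
  defect-signed i j with cubePoly≗poly i j
  ... | k , l , refl , e = Signed-resp (λ m → sym (defect-cong (+ (k ℕ.+ l)) e m)) (defectPoly-signed k l)

  -- D is linear, so it commutes with forming the defect; index 0 then gives the increment at time t
  -- scaled by 2ᵈ dᵗ⁺¹.
  D^-defect : ∀ d c t m → D^ t (defect d c) m ≡ D^ (suc t) c m - d * D^ t c m
  D^-defect d c zero m = refl
  D^-defect d c (suc t) m = begin
    D (D^ t (defect d c)) m                             ≡⟨ D-cong (D^-defect d c t) m ⟩
    D (λ n → D^ (suc t) c n - d * D^ t c n) m           ≡⟨ eq (+ m) (+ suc m) d (D^ (suc t) c m) (D^ t c m) (D^ (suc t) c (suc m)) (D^ t c (suc m)) ⟩
    D^ (suc (suc t)) c m - d * D^ (suc t) c m           ∎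
    where
    open ≡-Reasoning
    eq : ∀ n n′ d x y x′ y′ → n * (x - d * y) + n′ * (x′ - d * y′)
       ≡ (n * x + n′ * x′) - d * (n * y + n′ * y′)
    eq = solveℤ-∀

  increments-sign : ∀ {d} (i j : Vertex d) →
    AtMostOneSignChange (λ t → orbit (cubePoly i j) (suc t) - + d * orbit (cubePoly i j) t)
  increments-sign {d} i j with orbit-sign (defect-signed i j)
  ... | inj₁ h = inj₁ (λ t → subst (0ℤ ≤_) (D^-defect (+ d) (cubePoly i j) t 0) (h t))
  ... | inj₂ (s , b , a) = inj₂ (s
      , (λ t t<s → subst (0ℤ ≤_) (D^-defect (+ d) (cubePoly i j) t 0) (b t t<s))
      , (λ t s≤t → subst (_≤ 0ℤ) (D^-defect (+ d) (cubePoly i j) t 0) (a t s≤t)))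

  -- Neighbour sums and the recursion for the cube polynomials.

  neighbourSum : {A : Set} → (A → A → A) → A → ∀ {d} → Vertex d → (Vertex d → A) → A
  neighbourSum _⊕_ z [] f = z
  neighbourSum _⊕_ z (b ∷ j) f = neighbourSum _⊕_ z j (λ v → f (b ∷ v)) ⊕ f (not b ∷ j)

  N : ∀ {d} → Vertex d → (Vertex d → ℤ) → ℤ
  N = neighbourSum _+_ 0ℤ

  N-lin : ∀ {d} (j : Vertex d) a b f g → N j (λ v → a * f v + b * g v) ≡ a * N j f + b * N j g
  N-lin [] a b f g = eq a b
    where
    eq : ∀ a b → 0ℤ ≡ a * 0ℤ + b * 0ℤ
    eq = solveℤ-∀
  N-lin (c ∷ j) a b f g = trans (cong (_+ (a * f v + b * g v)) (N-lin j a b _ _))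
    (eq a b (N j (λ v → f (c ∷ v))) (N j (λ v → g (c ∷ v))) (f v) (g v))
    where
    v = not c ∷ j
    eq : ∀ a b x y x′ y′ → a * x + b * y + (a * x′ + b * y′) ≡ a * (x + x′) + b * (y + y′)
    eq = solveℤ-∀

  N-0 : ∀ {d} (j : Vertex d) → N j (λ _ → 0ℤ) ≡ 0ℤ
  N-0 [] = refl
  N-0 (_ ∷ j) = trans (+-identityʳ _) (N-0 j)

  N-U : ∀ {d} (j : Vertex d) (f : Vertex d → Seq) m → N j (λ v → U (f v) m) ≡ U (λ n → N j (λ v → f v n)) m
  N-U j f zero = N-0 j
  N-U j f (suc m) = refl

  N-W : ∀ {d} (j : Vertex d) (f : Vertex d → Seq) m → N j (λ v → W (f v) m) ≡ W (λ n → N j (λ v → f v n)) m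
  N-W j f m = begin
    N j (λ v → + 2 * f v m + U (f v) m)                   ≡⟨ N-cong j (λ v → cong (λ z → + 2 * f v m + z) (sym (*-identityˡ (U (f v) m)))) ⟩
    N j (λ v → + 2 * f v m + 1ℤ * U (f v) m)              ≡⟨ N-lin j (+ 2) 1ℤ _ _ ⟩
    + 2 * N j (λ v → f v m) + 1ℤ * N j (λ v → U (f v) m)  ≡⟨ cong (λ z → + 2 * N j (λ v → f v m) + z) (trans (*-identityˡ (N j (λ v → U (f v) m))) (N-U j f m)) ⟩
    W (λ n → N j (λ v → f v n)) m                         ∎
    where
    open ≡-Reasoning
    N-cong : ∀ {d} (j : Vertex d) {f g : Vertex d → ℤ} → f ≗ g → N j f ≡ N j g
    N-cong [] e = refl
    N-cong (b ∷ j) e = cong₂ _+_ (N-cong j (λ v → e (b ∷ v))) (e (not b ∷ j))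

  -- Flipping a bit of j swaps its factor between u and u + 2, and twice the derivative of either is
  -- 2 (u + 1) = u + (u + 2): the factor itself plus the flipped one. Summing over bits gives d
  -- copies of f and the neighbour sum.
  D-cubePoly : ∀ {d} (i j : Vertex d) m → + 2 * D (cubePoly i j) m ≡ + d * cubePoly i j m + N j (λ v → cubePoly i v m)
  D-cubePoly [] [] zero = refl
  D-cubePoly [] [] (suc m) = eq (+ m)
    where
    eq : ∀ n → + 2 * ((1ℤ + n) * 0ℤ + (+ 2 + n) * 0ℤ) ≡ 0ℤ * 0ℤ + 0ℤ
    eq = solveℤ-∀
  D-cubePoly {suc d} (a ∷ i) (b ∷ j) m = go a b
    where
    open ≡-Reasoning
    c S : Seq
    c = cubePoly i j
    S n = N j (λ v → cubePoly i v n)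
    U-IH : ∀ m → + 2 * U (D c) m ≡ + d * U c m + U S m
    U-IH zero = eq (+ d)
      where
      eq : ∀ d → + 2 * 0ℤ ≡ d * 0ℤ + 0ℤ
      eq = solveℤ-∀
    U-IH (suc m) = D-cubePoly i j m
    same : + 2 * D (W c) m ≡ + suc d * W c m + (N j (λ v → W (cubePoly i v) m) + U c m)
    same = begin
      + 2 * D (W c) m
        ≡⟨ cong (+ 2 *_) (D-W c m) ⟩
      + 2 * (+ 2 * D c m + U (D c) m + (c m + U c m))
        ≡⟨ eq₁ (D c m) (U (D c) m) (c m) (U c m) ⟩
      + 2 * (+ 2 * D c m) + + 2 * U (D c) m + + 2 * (c m + U c m)
        ≡⟨ cong₂ (λ x y → + 2 * x + y + + 2 * (c m + U c m)) (D-cubePoly i j m) (U-IH m) ⟩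
      + 2 * (+ d * c m + S m) + (+ d * U c m + U S m) + + 2 * (c m + U c m)
        ≡⟨ eq₂ (+ d) (c m) (S m) (U c m) (U S m) ⟩
      + suc d * W c m + (W S m + U c m)
        ≡⟨ cong (λ z → + suc d * W c m + (z + U c m)) (sym (N-W j (cubePoly i) m)) ⟩
      + suc d * W c m + (N j (λ v → W (cubePoly i v) m) + U c m) ∎
      where
      eq₁ : ∀ x y c u → + 2 * (+ 2 * x + y + (c + u)) ≡ + 2 * (+ 2 * x) + + 2 * y + + 2 * (c + u)
      eq₁ = solveℤ-∀
      eq₂ : ∀ d c s u t → + 2 * (d * c + s) + (d * u + t) + + 2 * (c + u)
          ≡ (1ℤ + d) * (+ 2 * c + u) + ((+ 2 * s + t) + u)
      eq₂ = solveℤ-∀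
    diff : + 2 * D (U c) m ≡ + suc d * U c m + (N j (λ v → U (cubePoly i v) m) + W c m)
    diff = begin
      + 2 * D (U c) m
        ≡⟨ cong (+ 2 *_) (D-U c m) ⟩
      + 2 * (U (D c) m + (c m + U c m))
        ≡⟨ *-distribˡ-+ (+ 2) (U (D c) m) _ ⟩
      + 2 * U (D c) m + + 2 * (c m + U c m)
        ≡⟨ cong (_+ + 2 * (c m + U c m)) (U-IH m) ⟩
      + d * U c m + U S m + + 2 * (c m + U c m)
        ≡⟨ eq (+ d) (c m) (U c m) (U S m) ⟩
      + suc d * U c m + (U S m + W c m)
        ≡⟨ cong (λ z → + suc d * U c m + (z + W c m)) (sym (N-U j (cubePoly i) m)) ⟩
      + suc d * U c m + (N j (λ v → U (cubePoly i v) m) + W c m) ∎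
      where
      eq : ∀ d c u t → d * u + t + + 2 * (c + u) ≡ (1ℤ + d) * u + (t + (+ 2 * c + u))
      eq = solveℤ-∀
    go : ∀ a b → + 2 * D (coordinate a b c) m
       ≡ + suc d * coordinate a b c m + (N j (λ v → coordinate a b (cubePoly i v) m) + coordinate a (not b) c m)
    go false false = same
    go true true = same
    go false true = diff
    go true false = diff

  -- Both D and the neighbour sum are linear and act on different variables, so the identity for t =
  -- 0 may be differentiated repeatedly.
  D^-cubePoly : ∀ {d} (i j : Vertex d) t m →
         + 2 * D^ (suc t) (cubePoly i j) m ≡ + d * D^ t (cubePoly i j) m + N j (λ v → D^ t (cubePoly i v) m)
  D^-cubePoly i j zero m = D-cubePoly i j m
  D^-cubePoly {d} i j (suc t) m = begin
    + 2 * (+ m * x m + + suc m * x (suc m))                           ≡⟨ eq₁ (+ m) (+ suc m) (x m) (x (suc m)) ⟩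
    + m * (+ 2 * x m) + + suc m * (+ 2 * x (suc m))                   ≡⟨ cong₂ (λ a b → + m * a + + suc m * b) (D^-cubePoly i j t m) (D^-cubePoly i j t (suc m)) ⟩
    + m * (+ d * y m + S m) + + suc m * (+ d * y (suc m) + S (suc m)) ≡⟨ eq₂ (+ m) (+ suc m) (+ d) (y m) (S m) (y (suc m)) (S (suc m)) ⟩
    + d * D y m + D S m                                               ≡⟨ cong (λ z → + d * D y m + z) (sym (N-lin j (+ m) (+ suc m) _ _)) ⟩
    + d * D y m + N j (λ v → D^ (suc t) (cubePoly i v) m)                    ∎
    where
    open ≡-Reasoning
    x y S : Seq
    x = D^ (suc t) (cubePoly i j)
    y = D^ t (cubePoly i j)
    S n = N j (λ v → D^ t (cubePoly i v) n)
    eq₁ : ∀ m n x y → + 2 * (m * x + n * y) ≡ m * (+ 2 * x) + n * (+ 2 * y)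
    eq₁ = solveℤ-∀
    eq₂ : ∀ m n d y s y′ s′ → m * (d * y + s) + n * (d * y′ + s′) ≡ d * (m * y + n * y′) + (m * s + n * s′)
    eq₂ = solveℤ-∀

open IntegerSequences

-- Integers and unit fractions inside ℚ.

open import Data.Rational using (ℚ; mkℚ; 0ℚ; 1ℚ; ½; _+_; _*_; _≤_; *≤*; NonNegative)
open import Data.Rational.Properties

ringℚ : AlmostCommutativeRing 0ℓ 0ℓ
ringℚ = fromCommutativeRing ℚ.+-*-commutativeRing (λ x → dec⇒maybe (0ℚ ℚ.≟ x))

-- The explicit denominator 1 lets closed values compute: `ι 0ℤ` is `0ℚ` and `½ * ι (+ 2)` is `1ℚ`.
ι : ℤ → ℚ
ι z = mkℚ z 0 (coprime-sym (1-coprimeTo ∣ z ∣))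

ι-+ : ∀ x y → ι (x ℤ.+ y) ≡ ι x + ι y
ι-+ x y = toℚᵘ-injective (ℚᵘ.≃-trans (ℚᵘ.*≡* (eq x y)) (ℚᵘ.≃-sym (toℚᵘ-homo-+ (ι x) (ι y))))
  where
  eq : ∀ x y → (x ℤ.+ y) ℤ.* 1ℤ ≡ (x ℤ.* 1ℤ ℤ.+ y ℤ.* 1ℤ) ℤ.* 1ℤ
  eq = solveℤ-∀

ι-* : ∀ x y → ι (x ℤ.* y) ≡ ι x * ι y
ι-* x y = toℚᵘ-injective (ℚᵘ.≃-trans (ℚᵘ.*≡* refl) (ℚᵘ.≃-sym (toℚᵘ-homo-* (ι x) (ι y))))

ι-mono : ∀ {x y} → x ℤ.≤ y → ι x ≤ ι y
ι-mono h = *≤* (ℤ.*-monoʳ-≤-nonNeg 1ℤ h)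

unitFraction : ℕ → ℚ
unitFraction k = mkℚ (+ 1) k (1-coprimeTo (suc k))

unitFraction-inverse : ∀ k → unitFraction k * ι (+ suc k) ≡ 1ℚ
unitFraction-inverse k = toℚᵘ-injective
  (ℚᵘ.≃-trans (toℚᵘ-homo-* (unitFraction k) (ι (+ suc k))) (ℚᵘ.*≡* (eq (+ suc k))))
  where
  eq : ∀ n → (1ℤ ℤ.* n) ℤ.* 1ℤ ≡ 1ℤ ℤ.* (n ℤ.* 1ℤ)
  eq = solveℤ-∀

inv2d-suc : ∀ k → inv2d (suc k) ≡ ½ * unitFraction k
inv2d-suc k = toℚᵘ-injective
  -- `k + 1 * suc k` is the predecessor of `2 * suc k`, because `mkℚᵘ` stores the denominator minus
  -- one.
  (ℚᵘ.≃-trans (toℚᵘ-fromℚᵘ (ℚᵘ.mkℚᵘ (+ 1) (k ℕ.+ 1 ℕ.* suc k)))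
  (ℚᵘ.≃-trans (ℚᵘ.*≡* refl) (ℚᵘ.≃-sym (toℚᵘ-homo-* ½ (unitFraction k)))))

-- Sums over the vertices and one step of the walk.

sumList : {A : Set} → (A → ℚ) → List A → ℚ
sumList f = foldr (λ v acc → f v + acc) 0ℚ

sumList-++ : {A : Set} (f : A → ℚ) (xs ys : List A) → sumList f (xs ++ ys) ≡ sumList f xs + sumList f ys
sumList-++ f [] ys = sym (+-identityˡ _)
sumList-++ f (x ∷ xs) ys = trans (cong (λ z → f x + z) (sumList-++ f xs ys)) (sym (+-assoc (f x) _ _))

sumList-cong : {A : Set} {f g : A → ℚ} → f ≗ g → sumList f ≗ sumList g
sumList-cong e [] = refl
sumList-cong e (x ∷ xs) = cong₂ _+_ (e x) (sumList-cong e xs)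

sumV-suc : ∀ {d} (f : Vertex (suc d) → ℚ) b →
  sumV (suc d) f ≡ sumV d (λ v → f (b ∷ v)) + sumV d (λ v → f (not b ∷ v))
sumV-suc {d} f false = trans (sumList-++ f (map (false ∷_) (allVertices d)) _)
  (cong₂ _+_ (foldr-map _ (false ∷_) 0ℚ (allVertices d)) (foldr-map _ (true ∷_) 0ℚ (allVertices d)))
sumV-suc f true = trans (sumV-suc f false) (+-comm (sumV _ (λ v → f (false ∷ v))) _)

Nℚ : ∀ {d} → Vertex d → (Vertex d → ℚ) → ℚ
Nℚ = neighbourSum _+_ 0ℚ

-- A common form for `P` and `Id`, closed under removing a coordinate: a differing bit turns the
-- weights (α, β) into (β, 0).
byDistance : ℚ → ℚ → ℕ → ℚ
byDistance α β 0 = α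
byDistance α β 1 = β
byDistance α β (suc (suc _)) = 0ℚ

byDistance-suc : ∀ α β n → byDistance α β (suc n) ≡ byDistance β 0ℚ n
byDistance-suc α β 0 = refl
byDistance-suc α β 1 = refl
byDistance-suc α β (suc (suc n)) = refl

hamming-same : ∀ {d} b (v j : Vertex d) → hamming (b ∷ v) (b ∷ j) ≡ hamming v j
hamming-same false v j = refl
hamming-same true v j = refl

hamming-diff : ∀ {d} b (v j : Vertex d) → hamming (not b ∷ v) (b ∷ j) ≡ suc (hamming v j)
hamming-diff false v j = refl
hamming-diff true v j = refl

-- Splitting on the first bit, the half agreeing with j keeps the weights, while in the other half
-- only the flipped neighbour of j retains a weight, namely β.
sum-byDistance : ∀ {d} α β (g : Vertex d → ℚ) j →
  sumV d (λ v → g v * byDistance α β (hamming v j)) ≡ α * g j + β * Nℚ j g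
sum-byDistance α β g [] = eq (g []) α β
  where
  eq : ∀ x α β → x * α + 0ℚ ≡ α * x + β * 0ℚ
  eq = solve-∀ ringℚ
sum-byDistance {suc d} α β g (b ∷ j) = begin
  sumV (suc d) (λ v → g v * byDistance α β (hamming v (b ∷ j)))
    ≡⟨ sumV-suc (λ v → g v * byDistance α β (hamming v (b ∷ j))) b ⟩
  sumV d (λ v → g (b ∷ v) * byDistance α β (hamming (b ∷ v) (b ∷ j))) +
  sumV d (λ v → g (not b ∷ v) * byDistance α β (hamming (not b ∷ v) (b ∷ j)))
    ≡⟨ cong₂ _+_
         (sumList-cong (λ v → cong (λ n → g (b ∷ v) * byDistance α β n) (hamming-same b v j)) (allVertices d))
         (sumList-cong (λ v → cong (g (not b ∷ v) *_)
           (trans (cong (byDistance α β) (hamming-diff b v j)) (byDistance-suc α β (hamming v j)))) (allVertices d)) ⟩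
  sumV d (λ v → g (b ∷ v) * byDistance α β (hamming v j)) +
  sumV d (λ v → g (not b ∷ v) * byDistance β 0ℚ (hamming v j))
    ≡⟨ cong₂ _+_ (sum-byDistance α β (λ v → g (b ∷ v)) j) (sum-byDistance β 0ℚ (λ v → g (not b ∷ v)) j) ⟩
  (α * g (b ∷ j) + β * x) + (β * g (not b ∷ j) + 0ℚ * y)
    ≡⟨ eq α β (g (b ∷ j)) x (g (not b ∷ j)) y ⟩
  α * g (b ∷ j) + β * (x + g (not b ∷ j)) ∎
  where
  open ≡-Reasoning
  x = Nℚ j (λ v → g (b ∷ v))
  y = Nℚ j (λ v → g (not b ∷ v))
  eq : ∀ α β a x b y → (α * a + β * x) + (β * b + 0ℚ * y) ≡ α * a + β * (x + b)
  eq = solve-∀ ringℚ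

hamming-refl : ∀ {d} (i : Vertex d) → hamming i i ≡ 0
hamming-refl [] = refl
hamming-refl (false ∷ i) = hamming-refl i
hamming-refl (true ∷ i) = hamming-refl i

hamming≡0 : ∀ {d} (i j : Vertex d) → hamming i j ≡ 0 → i ≡ j
hamming≡0 [] [] _ = refl
hamming≡0 (false ∷ i) (false ∷ j) h = cong (false ∷_) (hamming≡0 i j h)
hamming≡0 (true ∷ i) (true ∷ j) h = cong (true ∷_) (hamming≡0 i j h)
hamming≡0 (false ∷ i) (true ∷ j) ()
hamming≡0 (true ∷ i) (false ∷ j) ()

byDistance-far : ∀ α β n → n ≢ 0 → n ≢ 1 → byDistance α β n ≡ 0ℚ
byDistance-far α β 0 n≢0 _ = ⊥-elim (n≢0 refl)
byDistance-far α β 1 _ n≢1 = ⊥-elim (n≢1 refl)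
byDistance-far α β (suc (suc n)) _ _ = refl

P-byDistance : ∀ d i j → P d i j ≡ byDistance ½ (inv2d d) (hamming i j)
P-byDistance d i j with ≡-dec _≟ᴮ_ i j
... | yes refl = cong (byDistance ½ (inv2d d)) (sym (hamming-refl i))
... | no i≢j with hamming i j ℕ.≟ 1
...   | yes h≡1 = cong (byDistance ½ (inv2d d)) (sym h≡1)
...   | no h≢1 = sym (byDistance-far ½ (inv2d d) (hamming i j) (λ h≡0 → i≢j (hamming≡0 i j h≡0)) h≢1)

byDistance-10 : ∀ n → n ≢ 0 → byDistance 1ℚ 0ℚ n ≡ 0ℚ
byDistance-10 0 n≢0 = ⊥-elim (n≢0 refl)
byDistance-10 1 _ = refl
byDistance-10 (suc (suc n)) _ = refl

Id-byDistance : ∀ d i j → Id d i j ≡ byDistance 1ℚ 0ℚ (hamming i j)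
Id-byDistance d i j with ≡-dec _≟ᴮ_ i j
... | yes refl = cong (byDistance 1ℚ 0ℚ) (sym (hamming-refl i))
... | no i≢j = sym (byDistance-10 (hamming i j) (λ h≡0 → i≢j (hamming≡0 i j h≡0)))

matPow-step : ∀ d t (i j : Vertex d) →
  matPow d (P d) (suc t) i j ≡ ½ * matPow d (P d) t i j + inv2d d * Nℚ j (matPow d (P d) t i)
matPow-step d t i j = trans
  (sumList-cong (λ v → cong (matPow d (P d) t i v *_) (P-byDistance d v j)) (allVertices d))
  (sum-byDistance ½ (inv2d d) (matPow d (P d) t i) j)

-- Matrix powers as scaled orbits.

½^ : ℕ → ℚ
½^ zero = 1ℚ
½^ (suc n) = ½ * ½^ n

-- At u = 0 a differing bit contributes 0 and an agreeing bit 2, so f has constant term 2ᵈ when i =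
-- j and 0 otherwise.
Id-cubePoly : ∀ d (i j : Vertex d) → Id d i j ≡ ½^ d * ι (cubePoly i j 0)
Id-cubePoly d i j = trans (Id-byDistance d i j) (go i j)
  where
  open ≡-Reasoning
  go : ∀ {d} (i j : Vertex d) → byDistance 1ℚ 0ℚ (hamming i j) ≡ ½^ d * ι (cubePoly i j 0)
  go [] [] = refl
  go {suc d} (a ∷ i) (b ∷ j) = cases a b
    where
    same : byDistance 1ℚ 0ℚ (hamming i j) ≡ ½^ (suc d) * ι (W (cubePoly i j) 0)
    same = begin
      byDistance 1ℚ 0ℚ (hamming i j)                 ≡⟨ go i j ⟩
      ½^ d * ι (cubePoly i j 0)                             ≡⟨ eq (½^ d) (ι (cubePoly i j 0)) ⟩
      1ℚ * (½^ d * ι (cubePoly i j 0))                      ≡⟨⟩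
      (½ * ι (+ 2)) * (½^ d * ι (cubePoly i j 0))           ≡⟨ eq′ ½ (ι (+ 2)) (½^ d) (ι (cubePoly i j 0)) ⟩
      ½ * ½^ d * (ι (+ 2) * ι (cubePoly i j 0))             ≡⟨ cong (½ * ½^ d *_) (sym (ι-* (+ 2) (cubePoly i j 0))) ⟩
      ½ * ½^ d * ι (+ 2 ℤ.* cubePoly i j 0)                 ≡⟨ cong (λ z → ½ * ½^ d * ι z) (sym (ℤ.+-identityʳ _)) ⟩
      ½^ (suc d) * ι (W (cubePoly i j) 0)                   ∎
      where
      eq : ∀ h x → h * x ≡ 1ℚ * (h * x)
      eq = solve-∀ ringℚ
      eq′ : ∀ a b h x → (a * b) * (h * x) ≡ a * h * (b * x)
      eq′ = solve-∀ ringℚ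
    diff : byDistance 1ℚ 0ℚ (suc (hamming i j)) ≡ ½^ (suc d) * 0ℚ
    diff = trans (byDistance-10 (suc (hamming i j)) (λ ())) (sym (*-zeroʳ (½^ (suc d))))
    cases : ∀ a b → byDistance 1ℚ 0ℚ (hamming (a ∷ i) (b ∷ j)) ≡ ½^ (suc d) * ι (coordinate a b (cubePoly i j) 0)
    cases false false = same
    cases true true = same
    cases false true = diff
    cases true false = diff

-- κ k t = 1 / (2ᵈ dᵗ) with d = k + 1.
κ : ℕ → ℕ → ℚ
κ k zero = ½^ (suc k)
κ k (suc t) = unitFraction k * κ k t

Nℚ-cong : ∀ {d} (j : Vertex d) {f g : Vertex d → ℚ} → f ≗ g → Nℚ j f ≡ Nℚ j g
Nℚ-cong [] e = refl
Nℚ-cong (b ∷ j) e = cong₂ _+_ (Nℚ-cong j (λ v → e (b ∷ v))) (e (not b ∷ j))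

Nℚ-ι : ∀ {d} (j : Vertex d) x (f : Vertex d → ℤ) → Nℚ j (λ v → x * ι (f v)) ≡ x * ι (N j f)
Nℚ-ι [] x f = sym (*-zeroʳ x)
Nℚ-ι (b ∷ j) x f = begin
  Nℚ j (λ v → x * ι (f (b ∷ v))) + x * ι z     ≡⟨ cong (_+ x * ι z) (Nℚ-ι j x (λ v → f (b ∷ v))) ⟩
  x * ι y + x * ι z                            ≡⟨ sym (*-distribˡ-+ x (ι y) (ι z)) ⟩
  x * (ι y + ι z)                              ≡⟨ cong (x *_) (sym (ι-+ y z)) ⟩
  x * ι (y ℤ.+ z)                              ∎
  where
  open ≡-Reasoning
  y = N j (λ v → f (b ∷ v))
  z = f (not b ∷ j)

-- Both sides satisfy the same recursion in t: `matPow-step` on the left, `D^-cubePoly` on the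
-- right. The induction hypothesis is used at j and at all its neighbours.
matPow-orbit : ∀ k (i j : Vertex (suc k)) t → matPow (suc k) (P (suc k)) t i j ≡ κ k t * ι (orbit (cubePoly i j) t)
matPow-orbit k i j zero = Id-cubePoly (suc k) i j
matPow-orbit k i j (suc t) = begin
  matPow (suc k) (P (suc k)) (suc t) i j
    ≡⟨ matPow-step (suc k) t i j ⟩
  ½ * matPow (suc k) (P (suc k)) t i j + inv2d (suc k) * Nℚ j (matPow (suc k) (P (suc k)) t i)
    ≡⟨ cong₂ (λ x y → ½ * x + inv2d (suc k) * y) (matPow-orbit k i j t)
         (trans (Nℚ-cong j (λ v → matPow-orbit k i v t)) (Nℚ-ι j (κ k t) (λ v → orbit (cubePoly i v) t))) ⟩
  ½ * (κ k t * ι a) + inv2d (suc k) * (κ k t * ι s)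
    ≡⟨ cong₂ (λ x y → x + y * (κ k t * ι s)) (eq₁ ½ (κ k t) (ι a)) (inv2d-suc k) ⟩
  1ℚ * (½ * κ k t * ι a) + ½ * r * (κ k t * ι s)
    ≡⟨ cong (λ z → z * (½ * κ k t * ι a) + ½ * r * (κ k t * ι s)) (sym (unitFraction-inverse k)) ⟩
  r * ι (+ suc k) * (½ * κ k t * ι a) + ½ * r * (κ k t * ι s)
    ≡⟨ eq₂ r (ι (+ suc k)) ½ (κ k t) (ι a) (ι s) ⟩
  ½ * (r * κ k t) * (ι (+ suc k) * ι a + ι s)
    ≡⟨ cong (½ * (r * κ k t) *_) combine ⟩
  ½ * (r * κ k t) * (ι (+ 2) * ι a′)
    ≡⟨ eq₃ ½ (r * κ k t) (ι (+ 2)) (ι a′) ⟩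
  ½ * ι (+ 2) * (r * κ k t * ι a′)
    ≡⟨ *-identityˡ _ ⟩
  r * κ k t * ι a′ ∎
  where
  open ≡-Reasoning
  r = unitFraction k
  a a′ s : ℤ
  a = orbit (cubePoly i j) t
  a′ = orbit (cubePoly i j) (suc t)
  s = N j (λ v → orbit (cubePoly i v) t)
  combine : ι (+ suc k) * ι a + ι s ≡ ι (+ 2) * ι a′
  combine = begin
    ι (+ suc k) * ι a + ι s       ≡⟨ cong (_+ ι s) (sym (ι-* (+ suc k) a)) ⟩
    ι (+ suc k ℤ.* a) + ι s       ≡⟨ sym (ι-+ (+ suc k ℤ.* a) s) ⟩
    ι (+ suc k ℤ.* a ℤ.+ s)       ≡⟨ cong ι (sym (D^-cubePoly i j t 0)) ⟩
    ι (+ 2 ℤ.* a′)                ≡⟨ ι-* (+ 2) a′ ⟩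
    ι (+ 2) * ι a′                ∎
  eq₁ : ∀ h κ a → h * (κ * a) ≡ 1ℚ * (h * κ * a)
  eq₁ = solve-∀ ringℚ
  eq₂ : ∀ r n h κ a s → r * n * (h * κ * a) + h * r * (κ * s) ≡ h * (r * κ) * (n * a + s)
  eq₂ = solve-∀ ringℚ
  eq₃ : ∀ h x n a → h * x * (n * a) ≡ h * n * (x * a)
  eq₃ = solve-∀ ringℚ

½^-nonNeg : ∀ n → NonNegative (½^ n)
½^-nonNeg zero = _
½^-nonNeg (suc n) = nonNeg*nonNeg⇒nonNeg ½ (½^ n) {{½^-nonNeg n}}

κ-nonNeg : ∀ k t → NonNegative (κ k t)
κ-nonNeg k zero = ½^-nonNeg (suc k)
κ-nonNeg k (suc t) = nonNeg*nonNeg⇒nonNeg (unitFraction k) (κ k t) {{κ-nonNeg k t}}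

-- Puts two consecutive times over the same factor `κ k (suc t)`, so that comparing them reduces to
-- comparing integers.
κ-* : ∀ k t a → κ k t * ι a ≡ κ k (suc t) * ι (+ suc k ℤ.* a)
κ-* k t a = begin
  κ k t * ι a                            ≡⟨ sym (*-identityˡ _) ⟩
  1ℚ * (κ k t * ι a)                     ≡⟨ cong (_* (κ k t * ι a)) (sym (unitFraction-inverse k)) ⟩
  r * ι (+ suc k) * (κ k t * ι a)        ≡⟨ eq r (ι (+ suc k)) (κ k t) (ι a) ⟩
  r * κ k t * (ι (+ suc k) * ι a)        ≡⟨ cong (r * κ k t *_) (sym (ι-* (+ suc k) a)) ⟩
  r * κ k t * ι (+ suc k ℤ.* a)          ∎
  where
  open ≡-Reasoning
  r = unitFraction k
  eq : ∀ r n κ a → r * n * (κ * a) ≡ r * κ * (n * a)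
  eq = solve-∀ ringℚ

increment-≥0 : ∀ k (i j : Vertex (suc k)) t →
  0ℤ ℤ.≤ orbit (cubePoly i j) (suc t) ℤ.- + suc k ℤ.* orbit (cubePoly i j) t →
  matPow (suc k) (P (suc k)) t i j ≤ matPow (suc k) (P (suc k)) (suc t) i j
increment-≥0 k i j t h = subst₂ _≤_
  (sym (trans (matPow-orbit k i j t) (κ-* k t (orbit (cubePoly i j) t)))) (sym (matPow-orbit k i j (suc t)))
  (*-monoˡ-≤-nonNeg (κ k (suc t)) {{κ-nonNeg k (suc t)}} (ι-mono (ℤ.0≤i-j⇒j≤i h)))

increment-≤0 : ∀ k (i j : Vertex (suc k)) t →
  orbit (cubePoly i j) (suc t) ℤ.- + suc k ℤ.* orbit (cubePoly i j) t ℤ.≤ 0ℤ →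
  matPow (suc k) (P (suc k)) (suc t) i j ≤ matPow (suc k) (P (suc k)) t i j
increment-≤0 k i j t h = subst₂ _≤_
  (sym (matPow-orbit k i j (suc t))) (sym (trans (matPow-orbit k i j t) (κ-* k t (orbit (cubePoly i j) t))))
  (*-monoˡ-≤-nonNeg (κ k (suc t)) {{κ-nonNeg k (suc t)}} (ι-mono (ℤ.i-j≤0⇒i≤j h)))

-- From signs of increments to unimodality.

ascending : ∀ (f : ℕ → ℚ) x y → (∀ t → x ℕ.≤ t → t ℕ.< y → f t ≤ f (suc t)) → x ℕ.≤ y → f x ≤ f y
ascending f x y h x≤y with ℕ.m≤n⇒m<n∨m≡n x≤y
... | inj₂ refl = ≤-refl
ascending f x (suc y) h _ | inj₁ (s≤s x≤y) = ≤-trans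
  (ascending f x y (λ t x≤t t<y → h t x≤t (ℕ.m<n⇒m<1+n t<y)) x≤y) (h y x≤y ℕ.≤-refl)

descending : ∀ (f : ℕ → ℚ) x y → (∀ t → x ℕ.≤ t → t ℕ.< y → f (suc t) ≤ f t) → x ℕ.≤ y → f y ≤ f x
descending f x y h x≤y with ℕ.m≤n⇒m<n∨m≡n x≤y
... | inj₂ refl = ≤-refl
descending f x (suc y) h _ | inj₁ (s≤s x≤y) = ≤-trans (h y x≤y ℕ.≤-refl)
  (descending f x y (λ t x≤t t<y → h t x≤t (ℕ.m<n⇒m<1+n t<y)) x≤y)

ascending⇒unimodal : ∀ f → (∀ t → f t ≤ f (suc t)) → Unimodal f
-- With s = 0 the left piece is the single point 0 and the right piece is all of ℕ.
ascending⇒unimodal f h = 0 , inj₁ (λ x y _ _ → mono x y) , inj₁ (λ x y _ _ → mono x y)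
  where
  mono : ∀ x y → x ℕ.≤ y → f x ≤ f y
  mono x y = ascending f x y (λ t _ _ → h t)

peak⇒unimodal : ∀ f s → (∀ t → t ℕ.< s → f t ≤ f (suc t)) → (∀ t → s ℕ.≤ t → f (suc t) ≤ f t) → Unimodal f
peak⇒unimodal f s up down = s
  , inj₁ (λ x y _ y≤s → ascending f x y (λ t _ t<y → up t (ℕ.<-≤-trans t<y y≤s)))
  , inj₂ (λ x y s≤x _ → descending f x y (λ t x≤t _ → down t (ℕ.≤-trans s≤x x≤t)))

-- On a single vertex the matrix is the number 1/2, so the values 2⁻ᵗ decrease. The scaling `κ`
-- divides by d, which is why d = 0 is treated apart.
unimodal-dim0 : Unimodal (λ t → matPow 0 (P 0) t [] [])
unimodal-dim0 = peak⇒unimodal F 0 (λ _ ()) (λ t _ → dec t)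
  where
  F : ℕ → ℚ
  F t = matPow 0 (P 0) t [] []
  F-step : ∀ t → F (suc t) ≡ F t * ½
  F-step t = +-identityʳ (F t * ½)
  F-nonNeg : ∀ t → NonNegative (F t)
  F-nonNeg zero = _
  F-nonNeg (suc t) = subst NonNegative (sym (F-step t)) (nonNeg*nonNeg⇒nonNeg (F t) {{F-nonNeg t}} ½)
  dec : ∀ t → F (suc t) ≤ F t
  dec t = subst₂ _≤_ (sym (F-step t)) (*-identityʳ (F t))
    (*-monoˡ-≤-nonNeg (F t) {{F-nonNeg t}} (*≤* (ℤ.+≤+ (s≤s z≤n))))

mainTheorem6 : (d : ℕ) (i j : Vertex d) → Unimodal (λ t → matPow d (P d) t i j)
mainTheorem6 zero [] [] = unimodal-dim0
mainTheorem6 (suc k) i j with increments-sign i j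
... | inj₁ up = ascending⇒unimodal _ (λ t → increment-≥0 k i j t (up t))
... | inj₂ (s , up , down) = peak⇒unimodal _ s
  (λ t t<s → increment-≥0 k i j t (up t t<s)) (λ t s≤t → increment-≤0 k i j t (down t s≤t))
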